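{- Let $\mathcal B$ be a set of predicates whose input positions are all of constant type. Let $P$ be a $\mathcal B$-ground, input-linear program with input selectability, $Q$ a $\mathcal B$-ground query, and $\xi$ a delay-respecting derivation of $P\cup\{Q\}$. Then each query in $\xi$ is $\mathcal B$-ground.
   Context: Basics. A query is a finite sequence of atoms; a clause is $h\leftarrow B$ with $h$ an atom and $B$ a query. Built-in predicates are regarded as defined by possibly infinitely many fact clauses. Every predicate has a fixed mode, i.e. each argument position is either input or output; $p(\mathbf s,\mathbf t)$ denotes an atom with $\mathbf s$ (resp. $\mathbf t$) the vector of terms filling the input (resp. output) positions. In clause heads $p(\mathbf t_0,\mathbf s_{n+1})$, $\mathbf t_0$ is the input and $\mathbf s_{n+1}$ the output. A syntactic object is linear if each variable occurs in it at most once. A clause is input-linear if the vector of input terms of its head is linear; a program is input-linear if all its clauses are and it does not use the equality predicate $=$ with both arguments input. A flat term is a variable or a term $f(x_1,\dots,x_n)$, $n\ge 0$, with distinct variables $x_i$. A permutation $\pi$ on $\{1,\dots,n\}$ is extended by $\pi(i)=i$ outside $\{1,\dots,n\}$. Types. A type is a set of terms closed under instantiation. The variable type is the type that contains variables and hence all terms; any other type is a non-variable type. A constant type is a type consisting only of (possibly infinitely many) constants. Each argument position of each predicate has an associated type. $t:T$ means $t\in T$ (componentwise for vectors); $\models \varphi\Rightarrow \mathbf t:\mathbf T$ means that the implication holds after applying any substitution to all terms. A term is type-consistent (in a position of type $T$) if some instance of it is in $T$. Nicely moded. $Q=p_1(\mathbf s_1,\mathbf t_1),\dots,p_n(\mathbf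 s_n,\mathbf t_n)$ is $\pi$-nicely moded if $\mathbf t_1,\dots,\mathbf t_n$ is linear and for all $i$, $vars(\mathbf s_i)\cap\bigcup_{\pi(i)\le\pi(j)\le n}vars(\mathbf t_j)=\emptyset$. A clause $p(\mathbf t_0,\mathbf s_{n+1})\leftarrow Q$ is $\pi$-nicely moded if $Q$ is and $vars(\mathbf t_0)\cap\bigcup_{j=1}^n vars(\mathbf t_j)=\emptyset$. Well typed. With $p_i(\mathbf S_i,\mathbf T_i)$ the type of $p_i$, $Q$ is $\pi$-well typed if for all $i\in\{1,\dots,n\}$, $\models(\bigwedge_{1\le\pi(j)<\pi(i)}\mathbf t_j:\mathbf T_j)\Rightarrow\mathbf s_i:\mathbf S_i$. A clause $p(\mathbf t_0,\mathbf s_{n+1})\leftarrow Q$, with $p(\mathbf T_0,\mathbf S_{n+1})$ the type of $p$, is $\pi$-well typed if for all $i\in\{1,\dots,n+1\}$, $\models(\bigwedge_{0\le\pi(j)<\pi(i)}\mathbf t_j:\mathbf T_j)\Rightarrow\mathbf s_i:\mathbf S_i$. Simply typed. $Q$ is $\pi$-simply typed if it is $\pi$-nicely moded and $\pi$-well typed and $\mathbf t_1,\dots,\mathbf t_n$ is a vector of variables. A clause $p(\mathbf t_0,\mathbf s_{n+1})\leftarrow Q$ is $\pi$-simply typed if it is $\pi$-nicely moded and $\pi$-well typed, $\mathbf t_1,\dots,\mathbf t_n$ is a vector of variables, and $\mathbf t_0$ is a vector of flat type-consistent terms that has a variable in each position of variable type. "Permutation simply typed" means $\pi$-simply typed for some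 $\pi$ (for each clause, for programs). Bound/free. An input position of a predicate $p$ is bound (in $P$) if some clause head $p(\dots)$ in $P$ has a non-variable term there; an output position is bound if some body atom $p(\dots)$ in $P$ has a non-variable term there; otherwise it is free. Derivations. A program consists of clauses and, for each predicate $p/n$, a block declaration: a (possibly empty) set of atoms $p(b_1,\dots,b_n)$ with $b_i\in\{?,-\}$. An atom $p(t_1,\dots,t_n)$ is blocked if for some $p(b_1,\dots,b_n)$ in the declaration, $t_i$ is a variable for all $i$ with $b_i=-$; otherwise it is selectable. In a derivation step a query $Q_1,a,Q_2$ is replaced by $(Q_1,B,Q_2)\theta$, where $h\leftarrow B$ is a variant, renamed apart, of a program clause and $\theta$ is the most general unifier of the selected atom $a$ and $h$. A derivation of $P\cup\{Q\}$ is a sequence of such steps starting at $Q$; it is delay-respecting if the selected atom is always selectable. Input selectability. A permutation simply typed program $P$ has input selectability if every atom (using a predicate of $P$) that has variables in all free output positions is selectable in $P$ (1) only if it is non-variable in all bound input positions, and (2) if it is non-variable in all input positions of non-variable type. $\mathcal B$-ground. Let $P$ be a permutation simply typed program. A query is $\mathcal B$-ground if it is permutation simply typed and each atom using a predicate in $\mathcal B$ has ground terms in its input positions. An argument position $k$ of a predicate $p$ in $P$ is a $\mathcal B$-position if there is a clause $p(\mathbf t_0,\mathbf s_{n+1})\leftarrow p_1(\mathbf s_1,\mathbf t_1),\dots,p_n(\mathbf s_n,\mathbf t_n)$ in $P$ such that for some $i$ with $p_i\in\mathcal B$, some variable in $\mathbf s_i$ also occurs in position $k$ of the head $p(\mathbf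 t_0,\mathbf s_{n+1})$. The program $P$ is $\mathcal B$-ground if every $\mathcal B$-position of every predicate in $P$ is an input position of constant type, and an atom $p(\mathbf s,\mathbf t)$ with $p\notin\mathcal B$ is selectable only if it is non-variable in the $\mathcal B$-positions of $p$.
   Formalization: The statement fails as given (e.g. p ← q(X), b(X) with b in B), so two hypotheses are added: every variable in an input position of a body atom with predicate in B occurs in the clause head, and the types of all argument positions are non-empty. -}

module Defs where

open import Data.Fin as Fin using (Fin)
open import Data.Fin.Permutation using (Permutation′; _⟨$⟩ʳ_)
open import Data.List as List using (List; []; _∷_; _++_; length; concatMap)
open import Data.List.Membership.Propositional using (_∈_; _∉_)
open import Data.List.Relation.Binary.Disjoint.Propositional using (Disjoint)
open import Data.List.Relation.Unary.Any using (Any)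
open import Data.List.Relation.Unary.Unique.Propositional using (Unique)
open import Data.Maybe using (Maybe; just; nothing)
open import Data.Nat as ℕ using (ℕ; suc)
open import Data.Product using (∃-syntax; _×_)
open import Data.Sum using (_⊎_; inj₁; inj₂)
open import Data.Unit using (⊤)
open import Data.Vec as Vec using (Vec; []; _∷_)
open import Relation.Binary.PropositionalEquality using (_≡_)
open import Relation.Nullary using (¬_)

record Signature : Set₁ where
  field
    Sym   : Set
    arity : Sym → ℕ

module Terms (S : Signature) where
  open Signature S

  data Term : Set where
    var : ℕ → Term
    fun : (f : Sym) → Vec Term (arity f) → Term

  vars  : Term → List ℕ
  vars* : ∀ {n} → Vec Term n → List ℕ
  vars (var x)    = x ∷ []
  vars (fun f ts) = vars* ts
  vars* []        = []
  vars* (t ∷ ts)  = vars t ++ vars* ts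

  -- Finite support is not required.  On finitely many terms this makes no
  -- difference, and it only enlarges the class of most general unifiers.
  Subst : Set
  Subst = ℕ → Term

  infixl 8 _·_ _·*_
  _·_  : Term → Subst → Term
  _·*_ : ∀ {n} → Vec Term n → Subst → Vec Term n
  var x    · σ = σ x
  fun f ts · σ = fun f (ts ·* σ)
  []       ·* σ = []
  (t ∷ ts) ·* σ = t · σ ∷ ts ·* σ

  data IsVar : Term → Set where
    var : ∀ x → IsVar (var x)

  NonVar : Term → Set
  NonVar t = ¬ IsVar t

  Ground : Term → Set
  Ground t = ∀ x → x ∉ vars t

  data IsConstant : Term → Set where
    constant : ∀ f ts → arity f ≡ 0 → IsConstant (fun f ts)

  data Flat : Term → Set where
    var : ∀ x → Flat (var x)
    fun : ∀ f (xs : Vec ℕ (arity f)) → Unique (Vec.toList xs) → Flat (fun f (Vec.map var xs))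

  record Type : Set₁ where
    field
      member : Term → Set
      closed : ∀ t σ → member t → member (t · σ)

  infix 4 _∶_
  _∶_ : Term → Type → Set
  t ∶ T = Type.member T t

  NonEmpty VariableType NonVariableType ConstantType : Type → Set
  NonEmpty T        = ∃[ t ] t ∶ T
  VariableType T    = ∃[ x ] var x ∶ T
  NonVariableType T = ¬ VariableType T
  ConstantType T    = ∀ t → t ∶ T → IsConstant t

  TypeConsistent : Type → Term → Set
  TypeConsistent T t = ∃[ σ ] t · σ ∶ T

-- The argument positions of a predicate are grouped by mode, so that an atom
-- is literally p(s,t) with s its input and t its output vector.
record Language : Set₁ where
  field
    signature : Signature
  open Terms signature public
  field
    Pred       : Set
    #in #out   : Pred → ℕ
    inType     : ∀ p → Fin (#in p) → Type
    outType    : ∀ p → Fin (#out p) → Type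
    equality   : Pred
    eq-binary  : #in equality ℕ.+ #out equality ≡ 2

module Programs (L : Language) where
  open Language L public

  Position : Pred → Set
  Position p = Fin (#in p) ⊎ Fin (#out p)

  positionType : ∀ p → Position p → Type
  positionType p (inj₁ k) = inType p k
  positionType p (inj₂ k) = outType p k

  record Atom : Set where
    constructor atom
    field
      pred : Pred
      ins  : Vec Term (#in pred)
      outs : Vec Term (#out pred)
  open Atom public

  arg : (a : Atom) → Position (pred a) → Term
  arg a (inj₁ k) = Vec.lookup (ins a) k
  arg a (inj₂ k) = Vec.lookup (outs a) k

  Query : Set
  Query = List Atom

  infix 3 _⟵_
  record Clause : Set where
    constructor _⟵_
    field
      head : Atom
      body : Query
  open Clause public

  inVars outVars atomVars : Atom → List ℕ
  inVars a   = vars* (ins a)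
  outVars a  = vars* (outs a)
  atomVars a = inVars a ++ outVars a

  queryOutVars queryVars : Query → List ℕ
  queryOutVars = concatMap outVars
  queryVars    = concatMap atomVars

  clauseVars : Clause → List ℕ
  clauseVars C = atomVars (head C) ++ queryVars (body C)

  infixl 8 _·ᵃ_ _·ᵠ_ _·ᶜ_
  _·ᵃ_ : Atom → Subst → Atom
  atom p s t ·ᵃ σ = atom p (s ·* σ) (t ·* σ)

  _·ᵠ_ : Query → Subst → Query
  Q ·ᵠ σ = List.map (_·ᵃ σ) Q

  _·ᶜ_ : Clause → Subst → Clause
  (h ⟵ B) ·ᶜ σ = h ·ᵃ σ ⟵ B ·ᵠ σ

  data Mark : Set where
    ?? ─ : Mark

  -- A program is a possibly infinite set of clauses, because built-ins are
  -- given by possibly infinitely many facts.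
  record Program : Set₁ where
    field
      IsClause : Clause → Set
      block    : (p : Pred) → List (Position p → Mark)
  open Program public

  Blocked Selectable : Program → Atom → Set
  Blocked P a    = Any (λ b → ∀ k → b k ≡ ─ → IsVar (arg a k)) (block P (pred a))
  Selectable P a = ¬ Blocked P a

  data PredicateOf (P : Program) : Pred → Set where
    inHead : ∀ {C} → IsClause P C → PredicateOf P (pred (head C))
    inBody : ∀ {C a} → IsClause P C → a ∈ body C → PredicateOf P (pred a)

  InputLinear : Program → Set
  InputLinear P =
    (∀ C → IsClause P C → Unique (inVars (head C))) ×
    ¬ (PredicateOf P equality × #in equality ≡ 2)

  InsTyped OutsTyped : Atom → Subst → Set
  InsTyped a σ  = ∀ k → Vec.lookup (ins a) k · σ ∶ inType (pred a) k
  OutsTyped a σ = ∀ k → Vec.lookup (outs a) k · σ ∶ outType (pred a) k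

  module _ (Q : Query) (π : Permutation′ (length Q)) where

    infix 4 _≺_ _≼_
    _≺_ _≼_ : Fin (length Q) → Fin (length Q) → Set
    j ≺ i = (π ⟨$⟩ʳ j) Fin.< (π ⟨$⟩ʳ i)
    i ≼ j = (π ⟨$⟩ʳ i) Fin.≤ (π ⟨$⟩ʳ j)

    NicelyModed : Set
    NicelyModed =
      Unique (queryOutVars Q) ×
      (∀ i j → i ≼ j → Disjoint (inVars (List.lookup Q i)) (outVars (List.lookup Q j)))

    WellTyped : Set
    WellTyped = ∀ i σ →
      (∀ j → j ≺ i → OutsTyped (List.lookup Q j) σ) →
      InsTyped (List.lookup Q i) σ

    SimplyTyped : Set
    SimplyTyped =
      NicelyModed × WellTyped ×
      (∀ i k → IsVar (Vec.lookup (outs (List.lookup Q i)) k))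

  module _ (C : Clause) (π : Permutation′ (length (body C))) where

    NicelyModedClause : Set
    NicelyModedClause =
      NicelyModed (body C) π × Disjoint (inVars (head C)) (queryOutVars (body C))

    -- The head inputs have index 0 and the head outputs index n+1, both fixed
    -- by π, so the former always precede and the latter always come last.
    WellTypedClause : Set
    WellTypedClause =
      (∀ i σ → InsTyped (head C) σ →
        (∀ j → _≺_ (body C) π j i → OutsTyped (List.lookup (body C) j) σ) →
        InsTyped (List.lookup (body C) i) σ) ×
      (∀ σ → InsTyped (head C) σ →
        (∀ j → OutsTyped (List.lookup (body C) j) σ) →
        OutsTyped (head C) σ)

    SimplyTypedClause : Set
    SimplyTypedClause =
      NicelyModedClause × WellTypedClause ×
      (∀ i k → IsVar (Vec.lookup (outs (List.lookup (body C) i)) k)) ×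
      (∀ k → let t = Vec.lookup (ins (head C)) k
                 T = inType (pred (head C)) k
             in Flat t × TypeConsistent T t × (VariableType T → IsVar t))

  PermutationSimplyTypedQuery : Query → Set
  PermutationSimplyTypedQuery Q = ∃[ π ] SimplyTyped Q π

  PermutationSimplyTyped : Program → Set
  PermutationSimplyTyped P = ∀ C → IsClause P C → ∃[ π ] SimplyTypedClause C π

  data Bound (P : Program) : (p : Pred) → Position p → Set where
    input  : ∀ {C} → IsClause P C → (k : Fin (#in (pred (head C)))) →
             NonVar (arg (head C) (inj₁ k)) → Bound P (pred (head C)) (inj₁ k)
    output : ∀ {C a} → IsClause P C → a ∈ body C → (k : Fin (#out (pred a))) →
             NonVar (arg a (inj₂ k)) → Bound P (pred a) (inj₂ k)

  Free : Program → (p : Pred) → Position p → Set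
  Free P p k = ¬ Bound P p k

  InputSelectability : Program → Set
  InputSelectability P = ∀ a → PredicateOf P (pred a) →
    (∀ k → Free P (pred a) (inj₂ k) → IsVar (arg a (inj₂ k))) →
    (Selectable P a →
      ∀ k → Bound P (pred a) (inj₁ k) → NonVar (arg a (inj₁ k))) ×
    ((∀ k → NonVariableType (inType (pred a) k) → NonVar (arg a (inj₁ k))) →
      Selectable P a)

  Variant : Clause → Clause → Set
  Variant C C′ = (∃[ σ ] C ·ᶜ σ ≡ C′) × (∃[ σ ] C′ ·ᶜ σ ≡ C)

  Unifier MGU : Atom → Atom → Subst → Set
  Unifier a h θ = a ·ᵃ θ ≡ h ·ᵃ θ
  MGU a h θ = Unifier a h θ ×
    (∀ σ → Unifier a h σ → ∃[ τ ] ∀ x → σ x ≡ θ x · τ)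

  record Step (P : Program) (Q Q′ : Query) : Set where
    field
      left right : Query
      selected   : Atom
      clause     : Clause
      variant    : Clause
      θ          : Subst
      source     : Q ≡ left ++ selected ∷ right
      inProgram  : IsClause P clause
      isVariant  : Variant clause variant
      apart      : Disjoint (clauseVars variant) (queryVars Q)
      isMGU      : MGU selected (head variant) θ
      target     : Q′ ≡ (left ++ body variant ++ right) ·ᵠ θ

  -- Numbers of steps; nothing stands for infinitely many.
  infix 4 _≤∞_
  _≤∞_ : ℕ → Maybe ℕ → Set
  i ≤∞ just n  = i ℕ.≤ n
  i ≤∞ nothing = ⊤

  -- Queries beyond #steps are junk values.
  record Derivation (P : Program) (Q : Query) : Set where
    field
      #steps : Maybe ℕ
      query  : ℕ → Query
      start  : query 0 ≡ Q
      step   : ∀ i → suc i ≤∞ #steps → Step P (query i) (query (suc i))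
  open Derivation public

  DelayRespecting : ∀ {P Q} → Derivation P Q → Set
  DelayRespecting {P} ξ = ∀ i (i< : suc i ≤∞ #steps ξ) → Selectable P (Step.selected (step ξ i i<))

  infix 4 _QueryOf_
  _QueryOf_ : ∀ {P Q} → Query → Derivation P Q → Set
  R QueryOf ξ = ∃[ i ] (i ≤∞ #steps ξ × query ξ i ≡ R)

  module _ (𝓑 : Pred → Set) where

    ConstantInputs : Set
    ConstantInputs = ∀ p → 𝓑 p → ∀ k → ConstantType (inType p k)

    BGroundQuery : Query → Set
    BGroundQuery Q = PermutationSimplyTypedQuery Q ×
      (∀ a → a ∈ Q → 𝓑 (pred a) → ∀ k → Ground (Vec.lookup (ins a) k))

    data BPosition (P : Program) : (p : Pred) → Position p → Set where
      position : ∀ {C a x} → IsClause P C → a ∈ body C → 𝓑 (pred a) → x ∈ inVars a →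
        (k : Position (pred (head C))) → x ∈ vars (arg (head C) k) →
        BPosition P (pred (head C)) k

    BGroundProgram : Program → Set
    BGroundProgram P =
      (∀ p k → BPosition P p k →
        ∃[ i ] (k ≡ inj₁ i × ConstantType (inType p i))) ×
      (∀ a → ¬ 𝓑 (pred a) → Selectable P a →
        ∀ k → BPosition P (pred a) k → NonVar (arg a k))

    -- Without this, p ← q(X), b(X) with b in 𝓑 takes the 𝓑-ground query p to
    -- q(X), b(X), which is not 𝓑-ground: X occurs in no position of the head,
    -- so BGroundProgram says nothing about it.
    HeadDetermined : Program → Set
    HeadDetermined P = ∀ C a x → IsClause P C → a ∈ body C → 𝓑 (pred a) →
      x ∈ inVars a → x ∈ atomVars (head C)

  -- If q has an output of empty type, then q(X), p(f(Y)) is vacuously well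
  -- typed although p expects a constant, and p(Z) ← b(Z) with b in 𝓑 takes it
  -- to q(X), b(f(Y)).
  NonEmptyTypes : Set
  NonEmptyTypes = ∀ p k → NonEmpty (positionType p k)

{-# OPTIONS --safe #-}
module Submission where

-- Listing the atoms of a query in the order given by π turns π-simple typedness
-- into a property of lists, and a resolution step then replaces the selected
-- atom a by the clause body at its place in the order.  Input selectability and
-- input linearity make the inputs of the head h match those of a, and the
-- outputs of a are fresh variables, so a most general unifier can be written
-- down as δ; every other one differs from δ by a renaming.  Under δ no output
-- variable of the resolvent is bound, which preserves simple typedness.
--
-- For groundness, a variable in an input of a body atom in 𝓑 is, by flatness and
-- type consistency, itself the argument of h at a 𝓑-position.  Instantiating all
-- output variables of the query by members of their types shows that the
-- corresponding argument of a is a variable or a constant, and a variable is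
-- excluded whether or not the predicate of a is in 𝓑.

open import Defs
open import Algebra.Properties.CommutativeMonoid.Sum using (sum; sum-permute)
open import Data.Bool using (if_then_else_)
open import Data.Empty using (⊥; ⊥-elim)
open import Data.Fin as Fin using (Fin; zero; suc)
open import Data.Fin.Permutation as Perm using (Permutation; Permutation′; _⟨$⟩ʳ_; _⟨$⟩ˡ_)
open import Data.Fin.Properties using (toℕ-cast)
open import Data.List as List using (List; []; _∷_; [_]; _++_; length; concatMap)
open import Data.List.Membership.Propositional using (_∈_; _∉_; find; lose)
open import Data.List.Membership.Propositional.Properties
open import Data.List.Properties using (∷-injective; concatMap-++; tabulate-lookup; map-++; map-∘)
open import Data.List.Relation.Binary.Disjoint.Propositional using (Disjoint)
open import Data.List.Relation.Binary.Permutation.Homogeneous using (onIndices)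
open import Data.List.Relation.Binary.Permutation.Propositional as ↭
  using (_↭_; refl; prep; swap; ↭-sym; ↭-trans; ↭⇒↭ₛ)
open import Data.List.Relation.Binary.Permutation.Propositional.Properties as ↭
  using (∈-resp-↭; All-resp-↭; ↭-length; drop-mid; ++-commutativeMonoid)
import Data.List.Relation.Binary.Permutation.Setoid.Properties as ↭ₛ
open import Data.List.Relation.Unary.All as All using (All; []; _∷_)
import Data.List.Relation.Unary.All.Properties as All
open import Data.List.Relation.Unary.AllPairs using ([]; _∷_)
open import Data.List.Relation.Unary.Any as Any using (here; there)
open import Data.List.Relation.Unary.Unique.Propositional using (Unique)
import Data.List.Relation.Unary.Unique.Propositional.Properties as Unique
open import Data.Maybe using (just; nothing)
open import Data.Nat as ℕ using (ℕ; zero; suc; z≤n; s≤s)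
import Data.Nat.Properties as ℕ
open import Data.List.Membership.DecPropositional ℕ._≟_ using (_∈?_)
open import Data.Product using (∃-syntax; _×_; _,_; proj₁; proj₂)
open import Data.Sum using (_⊎_; inj₁; inj₂; [_,_]′)
open import Data.Unit using (⊤; tt)
open import Data.Vec as Vec using (Vec; []; _∷_)
import Data.Vec.Properties as Vec
open import Function using (_∘_; const)
open import Relation.Binary.PropositionalEquality hiding ([_])
open import Relation.Nullary using (¬_; yes; no; does)
open import Relation.Nullary.Decidable using (toSum)

-- Lists

module _ {A : Set} where

  Unique-++⁻ : ∀ (xs {ys} : List A) → Unique (xs ++ ys) →
               Unique xs × Unique ys × Disjoint xs ys
  Unique-++⁻ []       u        = [] , u , λ { (() , _) }
  Unique-++⁻ (x ∷ xs) (x∉ ∷ u) with Unique-++⁻ xs u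
  ... | ux , uy , d = All.++⁻ˡ xs x∉ ∷ ux , uy , λ where
    (here refl , y∈) → All.lookup (All.++⁻ʳ xs x∉) y∈ refl
    (there x∈ , y∈)  → d (x∈ , y∈)

  Unique-resp-↭ : ∀ {xs ys : List A} → xs ↭ ys → Unique xs → Unique ys
  Unique-resp-↭ p = ↭ₛ.Unique-resp-↭ (setoid A) (↭⇒↭ₛ p)

  Disjoint-map⁻ : ∀ {B : Set} (f : A → B) {xs ys} →
                  Disjoint (List.map f xs) (List.map f ys) → Disjoint xs ys
  Disjoint-map⁻ f d (x∈ , y∈) = d (∈-map⁺ f x∈ , ∈-map⁺ f y∈)

  map-fixed⁻ : ∀ (f : A → A) xs → List.map f xs ≡ xs → All (λ x → f x ≡ x) xs
  map-fixed⁻ f []       _  = []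
  map-fixed⁻ f (x ∷ xs) eq with ∷-injective eq
  ... | fx≡x , eq′ = fx≡x ∷ map-fixed⁻ f xs eq′

  concatMap-↭ : ∀ {B : Set} (f : A → List B) {xs ys} → xs ↭ ys → concatMap f xs ↭ concatMap f ys
  concatMap-↭ f refl        = refl
  concatMap-↭ f (prep x p)  = ↭.++⁺ˡ (f x) (concatMap-↭ f p)
  concatMap-↭ f (swap x y p) = ↭-trans (↭.shifts (f x) (f y))
    (↭.++⁺ˡ (f y) (↭.++⁺ˡ (f x) (concatMap-↭ f p)))
  concatMap-↭ f (↭.trans p q) = ↭-trans (concatMap-↭ f p) (concatMap-↭ f q)

  tabulate≡sum : ∀ {n} (f : Fin n → A) → List.tabulate f ≡ sum ++-commutativeMonoid ([_] ∘ f)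
  tabulate≡sum {zero}  f = refl
  tabulate≡sum {suc n} f = cong (f zero ∷_) (tabulate≡sum (f ∘ suc))

  -- tabulate is a sum in the commutative monoid of lists up to ↭.
  tabulate-permute : ∀ {n} (f : Fin n → A) (π : Permutation′ n) →
                     List.tabulate f ↭ List.tabulate (f ∘ (π ⟨$⟩ʳ_))
  tabulate-permute f π = subst₂ _↭_ (sym (tabulate≡sum f)) (sym (tabulate≡sum _))
    (sum-permute ++-commutativeMonoid ([_] ∘ f) π)

  permuteIndices : ∀ {xs ys : List A} → xs ↭ ys → Permutation (length xs) (length ys)
  permuteIndices p = onIndices (↭⇒↭ₛ p)

  lookup-permuteIndices : ∀ {xs ys : List A} (p : xs ↭ ys) i →
    List.lookup xs i ≡ List.lookup ys (permuteIndices p ⟨$⟩ʳ i)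
  lookup-permuteIndices p = ↭ₛ.onIndices-lookup (setoid A) (↭⇒↭ₛ p)

module Resolution (L : Language) where
  open Programs L
  open Signature signature using (arity)

  -- Substitutions

  infixl 9 _⊙_
  _⊙_ : Subst → Subst → Subst
  (σ ⊙ τ) x = σ x · τ

  ·-⊙  : ∀ t σ τ → t · σ · τ ≡ t · (σ ⊙ τ)
  ·*-⊙ : ∀ {n} (ts : Vec Term n) σ τ → ts ·* σ ·* τ ≡ ts ·* (σ ⊙ τ)
  ·-⊙ (var x)    σ τ = refl
  ·-⊙ (fun f ts) σ τ = cong (fun f) (·*-⊙ ts σ τ)
  ·*-⊙ []       σ τ = refl
  ·*-⊙ (t ∷ ts) σ τ = cong₂ _∷_ (·-⊙ t σ τ) (·*-⊙ ts σ τ)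

  ·-cong  : ∀ t {σ τ} → (∀ {x} → x ∈ vars t → σ x ≡ τ x) → t · σ ≡ t · τ
  ·*-cong : ∀ {n} (ts : Vec Term n) {σ τ} →
            (∀ {x} → x ∈ vars* ts → σ x ≡ τ x) → ts ·* σ ≡ ts ·* τ
  ·-cong (var x)    eq = eq (here refl)
  ·-cong (fun f ts) eq = cong (fun f) (·*-cong ts eq)
  ·*-cong []       eq = refl
  ·*-cong (t ∷ ts) eq = cong₂ _∷_ (·-cong t (eq ∘ ∈-++⁺ˡ)) (·*-cong ts (eq ∘ ∈-++⁺ʳ (vars t)))

  ·*-var : ∀ {n} (ts : Vec Term n) → ts ·* var ≡ ts
  ·-var : ∀ t → t · var ≡ t
  ·-var (var x)    = refl
  ·-var (fun f ts) = cong (fun f) (·*-var ts)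
  ·*-var []       = refl
  ·*-var (t ∷ ts) = cong₂ _∷_ (·-var t) (·*-var ts)

  ·*-fixed : ∀ {n} (ts : Vec Term n) {σ} → (∀ {x} → x ∈ vars* ts → σ x ≡ var x) → ts ·* σ ≡ ts
  ·*-fixed ts eq = trans (·*-cong ts eq) (·*-var ts)

  fun-injective : ∀ {f g ts us} → Term.fun f ts ≡ fun g us → f ≡ g
  fun-injective refl = refl

  args-injective : ∀ {f ts us} → Term.fun f ts ≡ fun f us → ts ≡ us
  args-injective refl = refl

  -- Equal instances agree below every variable occurrence; unification equations become pointwise
  -- equations between substitutions this way.
  ·-injective  : ∀ t {σ τ} → t · σ ≡ t · τ → ∀ {x} → x ∈ vars t → σ x ≡ τ x
  ·*-injective : ∀ {n} (ts : Vec Term n) {σ τ} → ts ·* σ ≡ ts ·* τ →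
                 ∀ {x} → x ∈ vars* ts → σ x ≡ τ x
  ·-injective (var x)    eq (here refl) = eq
  ·-injective (fun f ts) eq x∈          = ·*-injective ts (args-injective eq) x∈
  ·*-injective (t ∷ ts) eq x∈ with Vec.∷-injective eq | ∈-++⁻ (vars t) x∈
  ... | eq₁ , _ | inj₁ x∈t  = ·-injective t eq₁ x∈t
  ... | _ , eq₂ | inj₂ x∈ts = ·*-injective ts eq₂ x∈ts

  ∈-vars-·⁻  : ∀ t {σ y} → y ∈ vars (t · σ) → ∃[ x ] (x ∈ vars t × y ∈ vars (σ x))
  ∈-vars*-·⁻ : ∀ {n} (ts : Vec Term n) {σ y} → y ∈ vars* (ts ·* σ) →
               ∃[ x ] (x ∈ vars* ts × y ∈ vars (σ x))
  ∈-vars-·⁻ (var x)    y∈ = x , here refl , y∈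
  ∈-vars-·⁻ (fun f ts) y∈ = ∈-vars*-·⁻ ts y∈
  ∈-vars*-·⁻ (t ∷ ts) {σ} y∈ with ∈-++⁻ (vars (t · σ)) y∈
  ... | inj₁ y∈t  = let x , x∈ , y∈′ = ∈-vars-·⁻ t y∈t in x , ∈-++⁺ˡ x∈ , y∈′
  ... | inj₂ y∈ts = let x , x∈ , y∈′ = ∈-vars*-·⁻ ts y∈ts in x , ∈-++⁺ʳ (vars t) x∈ , y∈′

  ∈-vars-·⁺  : ∀ t {σ x y} → x ∈ vars t → y ∈ vars (σ x) → y ∈ vars (t · σ)
  ∈-vars*-·⁺ : ∀ {n} (ts : Vec Term n) {σ x y} → x ∈ vars* ts → y ∈ vars (σ x) →
               y ∈ vars* (ts ·* σ)
  ∈-vars-·⁺ (var x)    (here refl) y∈ = y∈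
  ∈-vars-·⁺ (fun f ts) x∈          y∈ = ∈-vars*-·⁺ ts x∈ y∈
  ∈-vars*-·⁺ (t ∷ ts) {σ} x∈ y∈ with ∈-++⁻ (vars t) x∈
  ... | inj₁ x∈t  = ∈-++⁺ˡ (∈-vars-·⁺ t x∈t y∈)
  ... | inj₂ x∈ts = ∈-++⁺ʳ (vars (t · σ)) (∈-vars*-·⁺ ts x∈ts y∈)

  lookup-·* : ∀ {n} (ts : Vec Term n) k σ → Vec.lookup (ts ·* σ) k ≡ Vec.lookup ts k · σ
  lookup-·* (t ∷ ts) zero    σ = refl
  lookup-·* (t ∷ ts) (suc k) σ = lookup-·* ts k σ

  lookup-·*-⊙ : ∀ {n} (ts : Vec Term n) k σ τ →
                Vec.lookup (ts ·* σ) k · τ ≡ Vec.lookup ts k · (σ ⊙ τ)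
  lookup-·*-⊙ ts k σ τ rewrite lookup-·* ts k σ = ·-⊙ (Vec.lookup ts k) σ τ

  ∈-vars*⁺ : ∀ {n} (ts : Vec Term n) k {x} → x ∈ vars (Vec.lookup ts k) → x ∈ vars* ts
  ∈-vars*⁺ (t ∷ ts) zero    x∈ = ∈-++⁺ˡ x∈
  ∈-vars*⁺ (t ∷ ts) (suc k) x∈ = ∈-++⁺ʳ (vars t) (∈-vars*⁺ ts k x∈)

  ∈-vars*⁻ : ∀ {n} (ts : Vec Term n) {x} → x ∈ vars* ts → ∃[ k ] x ∈ vars (Vec.lookup ts k)
  ∈-vars*⁻ (t ∷ ts) x∈ with ∈-++⁻ (vars t) x∈
  ... | inj₁ x∈t  = zero , x∈t
  ... | inj₂ x∈ts = let k , x∈k = ∈-vars*⁻ ts x∈ts in suc k , x∈k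

  constant⇒ground : ∀ t → IsConstant t → Ground t
  constant⇒ground (fun f ts) (constant _ _ arity≡0) x x∈ = noArgs ts arity≡0 x∈
    where
    noArgs : ∀ {n} (ts : Vec Term n) → n ≡ 0 → x ∉ vars* ts
    noArgs [] _ ()

  constant-·⁻ : ∀ t σ → IsConstant (t · σ) → IsVar t ⊎ IsConstant t
  constant-·⁻ (var x)    σ _                  = inj₁ (var x)
  constant-·⁻ (fun f ts) σ (constant _ _ eq) = inj₂ (constant f ts eq)

  glue : List ℕ → Subst → Subst → Subst
  glue xs σ τ x = if does (x ∈? xs) then σ x else τ x

  glue-∈ : ∀ xs σ τ {x} → x ∈ xs → glue xs σ τ x ≡ σ x
  glue-∈ xs σ τ {x} x∈ with x ∈? xs
  ... | yes _ = refl
  ... | no x∉ = ⊥-elim (x∉ x∈)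

  glue-∉ : ∀ xs σ τ {x} → x ∉ xs → glue xs σ τ x ≡ τ x
  glue-∉ xs σ τ {x} x∉ with x ∈? xs
  ... | yes x∈ = ⊥-elim (x∉ x∈)
  ... | no _   = refl

  -- Matching

  Matches : Term → Term → Set
  Matches u t = ∃[ μ ] u · μ ≡ t

  var-matches : ∀ {u} → IsVar u → ∀ t → Matches u t
  var-matches (var x) t = const t , refl

  -- Linearity keeps the variables of different components apart, so the separate matchers can be
  -- glued without conflict.
  matches* : ∀ {n} (us ts : Vec Term n) → Unique (vars* us) →
             (∀ k → Matches (Vec.lookup us k) (Vec.lookup ts k)) → ∃[ μ ] us ·* μ ≡ ts
  matches* []       []       _ _ = var , refl
  matches* (u ∷ us) (t ∷ ts) unique m
    with Unique-++⁻ (vars u) unique | m zero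
  ... | _ , unique′ , disjoint | μ , eq with matches* us ts unique′ (m ∘ suc)
  ... | ν , eqs = glue (vars u) μ ν , cong₂ _∷_
    (trans (·-cong u (glue-∈ (vars u) μ ν)) eq)
    (trans (·*-cong us (λ x∈ → glue-∉ (vars u) μ ν λ x∈u → disjoint (x∈u , x∈))) eqs)

  vars*-map-var : ∀ {n} (xs : Vec ℕ n) → vars* (Vec.map var xs) ≡ Vec.toList xs
  vars*-map-var []       = refl
  vars*-map-var (x ∷ xs) = cong (x ∷_) (vars*-map-var xs)

  -- A variable `u` matches anything. Otherwise both terms have a root symbol, the common instance
  -- makes the symbols equal, and the distinct variables below the root of `u` match any arguments.
  flat-matches : ∀ {u} t {σ θ} → Flat u → (NonVar u → NonVar t) → u · σ ≡ t · θ → Matches u t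
  flat-matches t (var x) _ _ = var-matches (var x) t
  flat-matches (var y) (fun f xs _) nonVar _ = ⊥-elim (nonVar (λ ()) (var y))
  flat-matches (fun g ts) (fun f xs unique) _ eq with fun-injective eq
  ... | refl = let μ , eq′ = matches* (Vec.map var xs) ts
                                (subst Unique (sym (vars*-map-var xs)) unique)
                                (λ k → var-matches (subst IsVar (sym (Vec.lookup-map k var xs))
                                                      (var (Vec.lookup xs k))) _)
               in μ , cong (fun f) eq′

  -- Ordered queries

  queryInVars : Query → List ℕ
  queryInVars = concatMap inVars

  inVars⊆queryVars : ∀ O {x} → x ∈ queryInVars O → x ∈ queryVars O
  inVars⊆queryVars O = ∈-concatMap⁺ atomVars ∘ Any.map ∈-++⁺ˡ ∘ ∈-concatMap⁻ inVars {O}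

  outVars⊆queryVars : ∀ O {x} → x ∈ queryOutVars O → x ∈ queryVars O
  outVars⊆queryVars O =
    ∈-concatMap⁺ atomVars ∘ Any.map (λ {a} → ∈-++⁺ʳ (inVars a)) ∘ ∈-concatMap⁻ outVars {O}

  ·ᵠ-⊙ : ∀ O σ τ → O ·ᵠ σ ·ᵠ τ ≡ O ·ᵠ (σ ⊙ τ)
  ·ᵠ-⊙ []               σ τ = refl
  ·ᵠ-⊙ (atom p s t ∷ O) σ τ =
    cong₂ _∷_ (cong₂ (atom p) (·*-⊙ s σ τ) (·*-⊙ t σ τ)) (·ᵠ-⊙ O σ τ)

  ·ᵠ-cong : ∀ O {σ τ} → (∀ x → σ x ≡ τ x) → O ·ᵠ σ ≡ O ·ᵠ τ
  ·ᵠ-cong []               eq = refl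
  ·ᵠ-cong (atom p s t ∷ O) eq = cong₂ _∷_
    (cong₂ (atom p) (·*-cong s λ {x} _ → eq x) (·*-cong t λ {x} _ → eq x)) (·ᵠ-cong O eq)

  queryOutVars-fixed : ∀ O {σ} → (∀ {x} → x ∈ queryOutVars O → σ x ≡ var x) →
                       queryOutVars (O ·ᵠ σ) ≡ queryOutVars O
  queryOutVars-fixed []      eq = refl
  queryOutVars-fixed (a ∷ O) eq = cong₂ _++_
    (cong vars* (·*-fixed (outs a) (eq ∘ ∈-++⁺ˡ)))
    (queryOutVars-fixed O (eq ∘ ∈-++⁺ʳ (outVars a)))

  -- The ordering condition of nice modedness for the identity permutation, stated by recursion so
  -- that it splits at `++`.
  Nice : Query → Set
  Nice []      = ⊤
  Nice (a ∷ O) = Disjoint (inVars a) (queryOutVars (a ∷ O)) × Nice O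

  Nice-++⁺ : ∀ O {O′} → Nice O → Nice O′ → Disjoint (queryInVars O) (queryOutVars O′) →
             Nice (O ++ O′)
  Nice-++⁺ []           _       n′ _ = n′
  Nice-++⁺ (a ∷ O) {O′} (d , n) n′ e =
    (λ { (x∈a , x∈) → [ (λ x∈O → d (x∈a , x∈O)) , (λ x∈O′ → e (∈-++⁺ˡ x∈a , x∈O′)) ]′
                        (∈-++⁻ (queryOutVars (a ∷ O))
                          (subst (_ ∈_) (concatMap-++ outVars (a ∷ O) O′) x∈)) }) ,
    Nice-++⁺ O n n′ (λ { (x∈O , x∈O′) → e (∈-++⁺ʳ (inVars a) x∈O , x∈O′) })

  Nice-++⁻ : ∀ O {O′} → Nice (O ++ O′) →
             Nice O × Nice O′ × Disjoint (queryInVars O) (queryOutVars O′)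
  Nice-++⁻ []           n = tt , n , λ { (() , _) }
  Nice-++⁻ (a ∷ O) {O′} (d , n) with Nice-++⁻ O n
  ... | nO , nO′ , e =
    ((λ { (x∈a , x∈) → d (x∈a , split (∈-++⁺ˡ x∈)) }) , nO) , nO′ ,
    λ { (x∈ , x∈O′) → [ (λ x∈a → d (x∈a , split (∈-++⁺ʳ (queryOutVars (a ∷ O)) x∈O′))) ,
                        (λ x∈O → e (x∈O , x∈O′)) ]′ (∈-++⁻ (inVars a) x∈) }
    where
    split : ∀ {x} → x ∈ queryOutVars (a ∷ O) ++ queryOutVars O′ → x ∈ queryOutVars (a ∷ O ++ O′)
    split = subst (_ ∈_) (sym (concatMap-++ outVars (a ∷ O) O′))

  Nice-tabulate : ∀ {n} (f : Fin n → Atom) →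
    (∀ i j → i Fin.≤ j → Disjoint (inVars (f i)) (outVars (f j))) → Nice (List.tabulate f)
  Nice-tabulate {zero}  f d = tt
  Nice-tabulate {suc n} f d =
    (λ { (x∈ , x∈′) → let b , b∈ , x∈b = find (∈-concatMap⁻ outVars {List.tabulate f} x∈′)
                          j , b≡       = ∈-tabulate⁻ {f = f} b∈
                      in d zero j z≤n (x∈ , subst (λ b → _ ∈ outVars b) b≡ x∈b) }) ,
    Nice-tabulate (f ∘ suc) (λ i j i≤j → d (suc i) (suc j) (s≤s i≤j))

  Nice-lookup : ∀ O → Nice O → ∀ i j → i Fin.≤ j →
                Disjoint (inVars (List.lookup O i)) (outVars (List.lookup O j))
  Nice-lookup (a ∷ O) (d , n) zero j _ (x∈ , x∈′) =
    d (x∈ , ∈-concatMap⁺ outVars (lose (∈-lookup {xs = a ∷ O} j) x∈′))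
  Nice-lookup (a ∷ O) (d , n) (suc i) (suc j) (s≤s i≤j) = Nice-lookup O n i j i≤j

  VariableOuts : Atom → Set
  VariableOuts a = ∀ k → IsVar (Vec.lookup (outs a) k)

  -- Together with `Typed` this is simple typedness in list order. The halves are separate because
  -- `Typed` passes to the resolvent under any unifier, whereas this one requires a most general
  -- unifier.
  record Moded (O : Query) : Set where
    constructor moded
    field
      linear  : Unique (queryOutVars O)
      nice    : Nice O
      varOuts : All VariableOuts O

  -- Assumption H holds before the first atom: for a clause body it says that
  -- the inputs of the head are correctly typed.
  Typed : (Subst → Set) → Query → Set
  Typed H []      = ⊤
  Typed H (a ∷ O) = (∀ σ → H σ → InsTyped a σ) × Typed (λ σ → H σ × OutsTyped a σ) O

  AllOutsTyped : Query → Subst → Set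
  AllOutsTyped O σ = All (λ a → OutsTyped a σ) O

  Typed-mono : ∀ O {H H′ : Subst → Set} → (∀ σ → H′ σ → H σ) → Typed H O → Typed H′ O
  Typed-mono []      f _       = tt
  Typed-mono (a ∷ O) f (t , w) =
    (λ σ → t σ ∘ f σ) , Typed-mono O (λ { σ (h , o) → f σ h , o }) w

  Typed-++⁺ : ∀ O {O′ H} → Typed H O → Typed (λ σ → H σ × AllOutsTyped O σ) O′ → Typed H (O ++ O′)
  Typed-++⁺ [] {O′}  _       w′ = Typed-mono O′ (λ σ h → h , []) w′
  Typed-++⁺ (a ∷ O) {O′} (t , w) w′ =
    t , Typed-++⁺ O w (Typed-mono O′ (λ { σ ((h , o) , os) → h , o ∷ os }) w′)

  Typed-++⁻ : ∀ O {O′ H} → Typed H (O ++ O′) → Typed H O × Typed (λ σ → H σ × AllOutsTyped O σ) O′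
  Typed-++⁻ [] {O′} w = tt , Typed-mono O′ (λ _ → proj₁) w
  Typed-++⁻ (a ∷ O) {O′} (t , w) with Typed-++⁻ O w
  ... | w₁ , w₂ = (t , w₁) , Typed-mono O′ (λ { σ (h , o ∷ os) → (h , o) , os }) w₂

  InsTyped-·⁺ : ∀ a σ τ → InsTyped a (σ ⊙ τ) → InsTyped (a ·ᵃ σ) τ
  InsTyped-·⁺ a σ τ t k = subst (_∶ inType (pred a) k) (sym (lookup-·*-⊙ (ins a) k σ τ)) (t k)

  InsTyped-·⁻ : ∀ a σ τ → InsTyped (a ·ᵃ σ) τ → InsTyped a (σ ⊙ τ)
  InsTyped-·⁻ a σ τ t k = subst (_∶ inType (pred a) k) (lookup-·*-⊙ (ins a) k σ τ) (t k)

  OutsTyped-·⁺ : ∀ a σ τ → OutsTyped a (σ ⊙ τ) → OutsTyped (a ·ᵃ σ) τ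
  OutsTyped-·⁺ a σ τ t k = subst (_∶ outType (pred a) k) (sym (lookup-·*-⊙ (outs a) k σ τ)) (t k)

  OutsTyped-·⁻ : ∀ a σ τ → OutsTyped (a ·ᵃ σ) τ → OutsTyped a (σ ⊙ τ)
  OutsTyped-·⁻ a σ τ t k = subst (_∶ outType (pred a) k) (lookup-·*-⊙ (outs a) k σ τ) (t k)

  AllOutsTyped-·⁻ : ∀ O σ τ → AllOutsTyped (O ·ᵠ σ) τ → AllOutsTyped O (σ ⊙ τ)
  AllOutsTyped-·⁻ O σ τ = All.map (λ {a} → OutsTyped-·⁻ a σ τ) ∘ All.map⁻

  -- Typing conditions quantify over all substitutions, so those of the instance at `τ` are the
  -- original ones at `σ ⊙ τ`; it remains to translate the assumptions.
  Typed-· : ∀ O σ {H H′ : Subst → Set} → (∀ τ → H′ τ → H (σ ⊙ τ)) → Typed H O → Typed H′ (O ·ᵠ σ)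
  Typed-· []      σ f _       = tt
  Typed-· (a ∷ O) σ f (t , w) =
    (λ τ → InsTyped-·⁺ a σ τ ∘ t (σ ⊙ τ) ∘ f τ) ,
    Typed-· O σ (λ { τ (h , o) → f τ h , OutsTyped-·⁻ a σ τ o }) w

  Typed-tabulate : ∀ {n} (f : Fin n → Atom) {H : Subst → Set} →
    (∀ i σ → H σ → (∀ j → j Fin.< i → OutsTyped (f j) σ) → InsTyped (f i) σ) →
    Typed H (List.tabulate f)
  Typed-tabulate {zero}  f t = tt
  Typed-tabulate {suc n} f t =
    (λ σ h → t zero σ h λ _ ()) ,
    Typed-tabulate (f ∘ suc) λ { i σ (h , o) os → t (suc i) σ h λ where
      zero    _         → o
      (suc j) (s≤s j<i) → os j j<i }

  Typed-lookup : ∀ O {H} → Typed H O → ∀ i σ → H σ →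
    (∀ j → j Fin.< i → OutsTyped (List.lookup O j) σ) → InsTyped (List.lookup O i) σ
  Typed-lookup (a ∷ O) (t , w) zero    σ h os = t σ h
  Typed-lookup (a ∷ O) (t , w) (suc i) σ h os =
    Typed-lookup O w i σ (h , os zero (s≤s z≤n)) (λ j j<i → os (suc j) (s≤s j<i))

  -- Position `i` of `O` receives the atom that `π` sends to `i`, which turns the order given by `π`
  -- into list order. The parameter `H` lets one construction serve both queries and clause bodies.
  arrange : ∀ Q (π : Permutation′ (length Q)) {H : Subst → Set} → NicelyModed Q π →
    (∀ i σ → H σ → (∀ j → _≺_ Q π j i → OutsTyped (List.lookup Q j) σ) →
      InsTyped (List.lookup Q i) σ) →
    (∀ i → VariableOuts (List.lookup Q i)) →
    ∃[ O ] (Q ↭ O × Moded O × Typed H O)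
  arrange Q π (linear , disjoint) typed varOuts =
    O , Q↭O ,
    moded (Unique-resp-↭ (concatMap-↭ outVars Q↭O) linear)
          (Nice-tabulate f λ i j i≤j → disjoint _ _
            (subst₂ Fin._≤_ (sym (Perm.inverseʳ π)) (sym (Perm.inverseʳ π)) i≤j))
          (All.tabulate⁺ λ i → varOuts _) ,
    Typed-tabulate f λ i σ h os → typed _ σ h λ j j≺ →
      subst (λ j → OutsTyped (List.lookup Q j) σ) (Perm.inverseˡ π)
        (os (π ⟨$⟩ʳ j) (subst ((π ⟨$⟩ʳ j) Fin.<_) (Perm.inverseʳ π) j≺))
    where
    f : Fin (length Q) → Atom
    f i = List.lookup Q (π ⟨$⟩ˡ i)
    O = List.tabulate f
    Q↭O : Q ↭ O
    Q↭O = subst (_↭ O) (tabulate-lookup Q) (tabulate-permute (List.lookup Q) (Perm.flip π))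

  -- The bijection of indices behind `Q ↭ O` numbers each atom of `Q` by its position in `O`, and
  -- this is the required permutation.
  unarrange : ∀ {Q O} → Q ↭ O → Moded O → Typed (const ⊤) O → PermutationSimplyTypedQuery Q
  unarrange {Q} {O} Q↭O (moded linear nice varOuts) typed =
    π , (Unique-resp-↭ (concatMap-↭ outVars (↭-sym Q↭O)) linear ,
         λ i j i≼j → subst₂ (λ a b → Disjoint (inVars a) (outVars b)) (sym (eq i)) (sym (eq j))
           (Nice-lookup O nice _ _ (subst₂ ℕ._≤_ (toℕ-π i) (toℕ-π j) i≼j))) ,
    (λ i σ os → subst (λ a → InsTyped a σ) (sym (eq i)) (Typed-lookup O typed _ σ tt λ j j< →
      let j≡ = Perm.inverseʳ ρ in
      subst (λ a → OutsTyped a σ) (trans (eq _) (cong (List.lookup O) j≡))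
        (os (ρ ⟨$⟩ˡ j) (subst₂ ℕ._<_ (trans (cong Fin.toℕ (sym j≡)) (sym (toℕ-π _)))
                                     (sym (toℕ-π i)) j<)))) ,
    λ i → All.lookup (All-resp-↭ (↭-sym Q↭O) varOuts) (∈-lookup i)
    where
    ρ = permuteIndices Q↭O
    eq = lookup-permuteIndices Q↭O
    -- `ρ` ends in the indices of `O`; the cast returns to those of `Q` without changing the
    -- underlying numbers.
    π = ρ Perm.∘ₚ Perm.cast-id (sym (↭-length Q↭O))
    toℕ-π : ∀ i → Fin.toℕ (π ⟨$⟩ʳ i) ≡ Fin.toℕ (ρ ⟨$⟩ʳ i)
    toℕ-π i = toℕ-cast (sym (↭-length Q↭O)) (ρ ⟨$⟩ʳ i)

  -- Renaming

  -- 0 is a junk value.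
  name : Term → ℕ
  name (var x)   = x
  name (fun _ _) = 0

  -- A local form of being a renaming: a left inverse of `ρ` on `xs` forces distinct members to go
  -- to distinct variables.
  Undoes : Subst → Subst → List ℕ → Set
  Undoes τ ρ xs = ∀ {x} → x ∈ xs → ρ x · τ ≡ var x

  module _ {ρ τ : Subst} where

    -- Mapping back recovers the list of occurrences with order and repetitions. A duplicate or
    -- shared variable after `ρ` would therefore be one before `ρ`; linearity and disjointness are
    -- transported in this way.
    vars-rename  : ∀ t → Undoes τ ρ (vars t) → List.map (name ∘ τ) (vars (t · ρ)) ≡ vars t
    vars*-rename : ∀ {n} (ts : Vec Term n) → Undoes τ ρ (vars* ts) →
                   List.map (name ∘ τ) (vars* (ts ·* ρ)) ≡ vars* ts
    vars-rename (fun f ts) u = vars*-rename ts u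
    vars-rename (var x)    u with ρ x | u (here refl)
    -- The other case is impossible, since an instance of a `fun` term is never a variable.
    ... | var z | eq = cong (λ t → [ name t ]) eq
    vars*-rename []       u = refl
    vars*-rename (t ∷ ts) u = trans (map-++ (name ∘ τ) (vars (t · ρ)) _)
      (cong₂ _++_ (vars-rename t (u ∘ ∈-++⁺ˡ)) (vars*-rename ts (u ∘ ∈-++⁺ʳ (vars t))))

    queryOutVars-rename : ∀ O → Undoes τ ρ (queryVars O) →
                          List.map (name ∘ τ) (queryOutVars (O ·ᵠ ρ)) ≡ queryOutVars O
    queryOutVars-rename []      u = refl
    queryOutVars-rename (a ∷ O) u = trans (map-++ (name ∘ τ) (outVars (a ·ᵃ ρ)) _)
      (cong₂ _++_ (vars*-rename (outs a) (u ∘ ∈-++⁺ˡ ∘ ∈-++⁺ʳ (inVars a)))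
                  (queryOutVars-rename O (u ∘ ∈-++⁺ʳ (atomVars a))))

    Disjoint-rename : ∀ {n} (ts : Vec Term n) O →
      Undoes τ ρ (vars* ts) → Undoes τ ρ (queryVars O) →
      Disjoint (vars* ts) (queryOutVars O) → Disjoint (vars* (ts ·* ρ)) (queryOutVars (O ·ᵠ ρ))
    Disjoint-rename ts O u v d = Disjoint-map⁻ (name ∘ τ)
      (subst₂ Disjoint (sym (vars*-rename ts u)) (sym (queryOutVars-rename O v)) d)

    Nice-rename : ∀ O → Undoes τ ρ (queryVars O) → Nice O → Nice (O ·ᵠ ρ)
    Nice-rename []      u _       = tt
    Nice-rename (a ∷ O) u (d , n) =
      Disjoint-rename (ins a) (a ∷ O) (u ∘ ∈-++⁺ˡ ∘ ∈-++⁺ˡ) u d ,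
      Nice-rename O (u ∘ ∈-++⁺ʳ (atomVars a)) n

    VariableOuts-rename : ∀ a → Undoes τ ρ (outVars a) → VariableOuts a → VariableOuts (a ·ᵃ ρ)
    VariableOuts-rename a u v k = subst IsVar (sym (lookup-·* (outs a) k ρ))
      (variable-· (v k) (u ∘ ∈-vars*⁺ (outs a) k))
      where
      variable-· : ∀ {t} → IsVar t → Undoes τ ρ (vars t) → IsVar (t · ρ)
      variable-· (var x) u with ρ x | u (here refl)
      ... | var z | _ = var z

    Moded-rename : ∀ O → Undoes τ ρ (queryVars O) → Moded O → Moded (O ·ᵠ ρ)
    Moded-rename O u (moded linear nice varOuts) = moded
      (Unique.map⁻ (subst Unique (sym (queryOutVars-rename O u)) linear))
      (Nice-rename O u nice)
      (All.map⁺ (All.tabulate λ {a} a∈ → VariableOuts-rename a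
        (λ x∈ → u (outVars⊆queryVars O (∈-concatMap⁺ outVars (lose a∈ x∈))))
        (All.lookup varOuts a∈)))

  -- The outputs are unchanged, and an instantiated input contributes either a variable that was
  -- there already or one that is no output, so a clash would be an old one.
  Nice-· : ∀ O {δ} → (∀ {x} → x ∈ queryOutVars O → δ x ≡ var x) →
    (∀ {x y} → x ∈ queryInVars O → y ∈ vars (δ x) → y ≡ x ⊎ y ∉ queryOutVars O) →
    Nice O → Nice (O ·ᵠ δ)
  Nice-· []      fixed fresh _       = tt
  Nice-· (a ∷ O) fixed fresh (d , n) =
    (λ { (y∈ , y∈out) → let x , x∈ , y∈δx = ∈-vars*-·⁻ (ins a) y∈
                            y∈O = subst (_ ∈_) (queryOutVars-fixed (a ∷ O) fixed) y∈out
                        in [ (λ y≡x → d (subst (_∈ inVars a) (sym y≡x) x∈ , y∈O)) , (λ y∉ → y∉ y∈O) ]′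
                             (fresh (∈-++⁺ˡ x∈) y∈δx) }) ,
    Nice-· O (fixed ∘ ∈-++⁺ʳ (outVars a))
      (λ x∈ y∈ → [ inj₁ , (λ y∉ → inj₂ (y∉ ∘ ∈-++⁺ʳ (outVars a))) ]′
                   (fresh (∈-++⁺ʳ (inVars a) x∈) y∈)) n

  ∈-queryInVars-· : ∀ O {δ y} → y ∈ queryInVars (O ·ᵠ δ) → ∃[ x ] (x ∈ queryInVars O × y ∈ vars (δ x))
  ∈-queryInVars-· (a ∷ O) {δ} y∈ with ∈-++⁻ (inVars (a ·ᵃ δ)) y∈
  ... | inj₁ y∈a = let x , x∈ , y∈′ = ∈-vars*-·⁻ (ins a) y∈a in x , ∈-++⁺ˡ x∈ , y∈′
  ... | inj₂ y∈O = let x , x∈ , y∈′ = ∈-queryInVars-· O y∈O in x , ∈-++⁺ʳ (inVars a) x∈ , y∈′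

  ∈-queryVars-· : ∀ O {δ y} → y ∈ queryVars (O ·ᵠ δ) → ∃[ x ] y ∈ vars (δ x)
  ∈-queryVars-· O {δ} y∈ with find (∈-concatMap⁻ atomVars {O ·ᵠ δ} y∈)
  ... | b , b∈ , y∈b with ∈-map⁻ (_·ᵃ δ) b∈
  ... | a , _ , refl with ∈-++⁻ (inVars (a ·ᵃ δ)) y∈b
  ... | inj₁ y∈ins  = let x , _ , y∈x = ∈-vars*-·⁻ (ins a) y∈ins in x , y∈x
  ... | inj₂ y∈outs = let x , _ , y∈x = ∈-vars*-·⁻ (outs a) y∈outs in x , y∈x

  -- Resolvents

  atom-injective : ∀ {p s t u v} → atom p s t ≡ atom p u v → s ≡ u × t ≡ v
  atom-injective refl = refl , refl

  -- `pre` and `post` surround the selected atom in the arranged order, and `D` is the arranged body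
  -- of the renamed clause. Since the inputs are matched and not merely unified, the variables of
  -- `s` can stay unbound.
  module Resolvent
    {p} {s u : Vec Term (#in p)} {t v : Vec Term (#out p)} {pre post D : Query}
    (modedQ : Moded (pre ++ atom p s t ∷ post)) (modedD : Moded D)
    (headNice : Disjoint (vars* u) (queryOutVars D))
    (apart : Disjoint (clauseVars (atom p u v ⟵ D)) (queryVars (pre ++ atom p s t ∷ post)))
    {μ} (match : u ·* μ ≡ s)
    where

    open Moded

    private
      a = atom p s t
      h = atom p u v
      niceQ = Nice-++⁻ pre (nice modedQ)
      uniqueQ = Unique-++⁻ (queryOutVars pre)
        (subst Unique (concatMap-++ outVars pre (a ∷ post)) (linear modedQ))
      uniqueAP = Unique-++⁻ (outVars a) (proj₁ (proj₂ uniqueQ))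

    inVars#outVars : Disjoint (vars* s) (vars* t)
    inVars#outVars (x∈s , x∈t) = proj₁ (proj₁ (proj₂ niceQ)) (x∈s , ∈-++⁺ˡ x∈t)

    inVars#post : Disjoint (vars* s) (queryOutVars post)
    inVars#post (x∈s , x∈) = proj₁ (proj₁ (proj₂ niceQ)) (x∈s , ∈-++⁺ʳ (vars* t) x∈)

    data QueryVar (x : ℕ) : Set where
      inPre  : x ∈ queryVars pre → QueryVar x
      inIns  : x ∈ vars* s → QueryVar x
      inOuts : x ∈ vars* t → QueryVar x
      inPost : x ∈ queryVars post → QueryVar x

    data ClauseVar (x : ℕ) : Set where
      inIns  : x ∈ vars* u → ClauseVar x
      inOuts : x ∈ vars* v → ClauseVar x
      inBody : x ∈ queryVars D → ClauseVar x

    ¬common : ∀ {x} → ClauseVar x → QueryVar x → ⊥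
    ¬common {x} c q = apart
      (clause c , subst (x ∈_) (sym (concatMap-++ atomVars pre (a ∷ post))) (query′ q))
      where
      clause : ClauseVar x → x ∈ clauseVars (h ⟵ D)
      clause (inIns x∈)  = ∈-++⁺ˡ (∈-++⁺ˡ x∈)
      clause (inOuts x∈) = ∈-++⁺ˡ (∈-++⁺ʳ (vars* u) x∈)
      clause (inBody x∈) = ∈-++⁺ʳ (atomVars h) x∈
      query′ : QueryVar x → x ∈ queryVars pre ++ queryVars (a ∷ post)
      query′ (inPre x∈)  = ∈-++⁺ˡ x∈
      query′ (inIns x∈)  = ∈-++⁺ʳ (queryVars pre) (∈-++⁺ˡ (∈-++⁺ˡ x∈))
      query′ (inOuts x∈) = ∈-++⁺ʳ (queryVars pre) (∈-++⁺ˡ (∈-++⁺ʳ (vars* s) x∈))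
      query′ (inPost x∈) = ∈-++⁺ʳ (queryVars pre) (∈-++⁺ʳ (atomVars a) x∈)

    -- A matcher is arbitrary outside `u`, so `μ` is cut down to the variables of `u`.
    inputMatch : Subst
    inputMatch = glue (vars* u) μ var

    private
      outputs : ∃[ ν ] t ·* ν ≡ v ·* inputMatch
      outputs = matches* t (v ·* inputMatch) (proj₁ uniqueAP)
        (λ k → var-matches (All.lookup (varOuts modedQ) (∈-++⁺ʳ pre (here refl)) k) _)
      ν = proj₁ outputs

    -- The head inputs are matched against the inputs of a, and then the
    -- output variables of a are bound to the instantiated head outputs.
    δ : Subst
    δ = glue (vars* t) ν inputMatch

    δ-out : t ·* δ ≡ v ·* inputMatch
    δ-out = trans (·*-cong t (glue-∈ (vars* t) ν inputMatch)) (proj₂ outputs)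

    inputMatch-ins : u ·* inputMatch ≡ s
    inputMatch-ins = trans (·*-cong u (glue-∈ (vars* u) μ var)) match

    δ-∉ : ∀ {x} → x ∉ vars* t → δ x ≡ inputMatch x
    δ-∉ = glue-∉ (vars* t) ν inputMatch

    δ-fixed : ∀ {x} → x ∉ vars* t → x ∉ vars* u → δ x ≡ var x
    δ-fixed x∉t x∉u = trans (δ-∉ x∉t) (glue-∉ (vars* u) μ var x∉u)

    δ-unifier : Unifier a h δ
    δ-unifier = cong₂ (atom p)
      (trans (·*-fixed s (λ x∈ → δ-fixed (λ x∈t → inVars#outVars (x∈ , x∈t))
                                         (λ x∈u → ¬common (inIns x∈u) (inIns x∈))))
        (sym (trans (·*-cong u (λ x∈ → δ-∉ (λ x∈t → ¬common (inIns x∈) (inOuts x∈t))))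
                    inputMatch-ins)))
      (trans δ-out (sym (·*-cong v (λ x∈ → δ-∉ (λ x∈t → ¬common (inOuts x∈) (inOuts x∈t))))))

    inputMatch-absorbs : ∀ {θ} → s ·* θ ≡ u ·* θ → ∀ x → inputMatch x · θ ≡ θ x
    inputMatch-absorbs {θ} eq x with x ∈? vars* u
    ... | no x∉  = refl
    ... | yes x∈ = ·*-injective u
      (trans (sym (·*-⊙ u μ θ)) (trans (cong (_·* θ) match) eq)) x∈

    -- `δ` binds variables only by matching one side of an equation that `θ` solves, so applying `δ`
    -- before `θ` changes nothing. Hence every unifier factors through `δ` with itself as second
    -- factor.
    δ-absorbs : ∀ {θ} → s ·* θ ≡ u ·* θ → t ·* θ ≡ v ·* θ → ∀ x → δ x · θ ≡ θ x
    δ-absorbs {θ} eqᵢ eqₒ x with x ∈? vars* t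
    ... | no x∉  = inputMatch-absorbs eqᵢ x
    ... | yes x∈ = ·*-injective t
      (trans (sym (·*-⊙ t ν θ)) (trans (cong (_·* θ) (proj₂ outputs))
        (trans (·*-⊙ v inputMatch θ)
          (trans (·*-cong v (λ {x} _ → inputMatch-absorbs eqᵢ x)) (sym eqₒ))))) x∈

    ∈-inputMatch : ∀ {x y} → y ∈ vars (inputMatch x) → y ∈ vars* s ⊎ y ≡ x
    ∈-inputMatch {x} y∈ with x ∈? vars* u
    ∈-inputMatch {x} y∈          | yes x∈ =
      inj₁ (subst (λ ts → _ ∈ vars* ts) match (∈-vars*-·⁺ u x∈ y∈))
    ∈-inputMatch {x} (here refl) | no _   = inj₂ refl

    ∈-δ-out : ∀ {x y} → x ∈ vars* t → y ∈ vars (δ x) → y ∈ vars* s ⊎ y ∈ vars* v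
    ∈-δ-out x∈ y∈
      with ∈-vars*-·⁻ v (subst (λ ts → _ ∈ vars* ts) δ-out (∈-vars*-·⁺ t x∈ y∈))
    ... | z , z∈v , y∈z with ∈-inputMatch y∈z
    ...   | inj₁ y∈s  = inj₁ y∈s
    ...   | inj₂ refl = inj₂ z∈v

    ∈-δ-∉ : ∀ {x y} → x ∉ vars* t → y ∈ vars (δ x) → y ∈ vars* s ⊎ y ≡ x
    ∈-δ-∉ x∉ y∈ = ∈-inputMatch (subst (λ t → _ ∈ vars t) (δ-∉ x∉) y∈)

    data OutVar (x : ℕ) : Set where
      inPre  : x ∈ queryOutVars pre → OutVar x
      inBody : x ∈ queryOutVars D → OutVar x
      inPost : x ∈ queryOutVars post → OutVar x

    -- `δ` moves at most the output variables of `a` and the input variables of `h`. Linearity of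
    -- the query outputs, nice modedness of the clause and renaming apart keep the other outputs
    -- clear of both.
    δ-outVar : ∀ {x} → OutVar x → δ x ≡ var x
    δ-outVar (inPre x∈)  = δ-fixed
      (λ x∈t → proj₂ (proj₂ uniqueQ) (x∈ , ∈-++⁺ˡ x∈t))
      (λ x∈u → ¬common (inIns x∈u) (inPre (outVars⊆queryVars pre x∈)))
    δ-outVar (inBody x∈) = δ-fixed
      (λ x∈t → ¬common (inBody (outVars⊆queryVars D x∈)) (inOuts x∈t))
      (λ x∈u → headNice (x∈u , x∈))
    δ-outVar (inPost x∈) = δ-fixed
      (λ x∈t → proj₂ (proj₂ uniqueAP) (x∈t , x∈))
      (λ x∈u → ¬common (inIns x∈u) (inPost (outVars⊆queryVars post x∈)))

    -- By nice modedness, atoms before `a` do not consume its outputs.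
    δ-pre : ∀ {x} → x ∈ queryInVars pre → δ x ≡ var x
    δ-pre x∈ = δ-fixed
      (λ x∈t → proj₂ (proj₂ niceQ) (x∈ , ∈-++⁺ˡ x∈t))
      (λ x∈u → ¬common (inIns x∈u) (inPre (inVars⊆queryVars pre x∈)))

    outVar : ∀ {x} → x ∈ queryOutVars (pre ++ D ++ post) → OutVar x
    outVar {x} x∈ with ∈-++⁻ (queryOutVars pre)
                         (subst (x ∈_) (concatMap-++ outVars pre (D ++ post)) x∈)
    ... | inj₁ x∈pre = inPre x∈pre
    ... | inj₂ x∈′ with ∈-++⁻ (queryOutVars D) (subst (x ∈_) (concatMap-++ outVars D post) x∈′)
    ...   | inj₁ x∈D    = inBody x∈D
    ...   | inj₂ x∈post = inPost x∈post

    outs-fixed : ∀ O → (∀ {x} → x ∈ queryOutVars O → OutVar x) →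
                 queryOutVars (O ·ᵠ δ) ≡ queryOutVars O
    outs-fixed O f = queryOutVars-fixed O (δ-outVar ∘ f)

    bodyInVar : ∀ {x} → x ∈ queryInVars D → x ∉ vars* t
    bodyInVar x∈ x∈t = ¬common (inBody (inVars⊆queryVars D x∈)) (inOuts x∈t)

    nice-pre : Nice (pre ·ᵠ δ)
    nice-pre = Nice-· pre (δ-outVar ∘ inPre)
      (λ { {x} {y} x∈ y∈ → inj₁ (fixed (subst (λ t → y ∈ vars t) (δ-pre x∈) y∈)) })
      (proj₁ niceQ)
      where
      fixed : ∀ {x y} → y ∈ [ x ] → y ≡ x
      fixed (here eq) = eq

    nice-body : Nice (D ·ᵠ δ)
    nice-body = Nice-· D (δ-outVar ∘ inBody)
      (λ x∈ y∈ → [ (λ y∈s → inj₂ λ y∈D →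
                      ¬common (inBody (outVars⊆queryVars D y∈D)) (inIns y∈s)) , inj₁ ]′
                   (∈-δ-∉ (bodyInVar x∈) y∈))
      (nice modedD)

    nice-post : Nice (post ·ᵠ δ)
    nice-post = Nice-· post (δ-outVar ∘ inPost) fresh (proj₂ (proj₁ (proj₂ niceQ)))
      where
      fresh : ∀ {x y} → x ∈ queryInVars post → y ∈ vars (δ x) → y ≡ x ⊎ y ∉ queryOutVars post
      fresh {x} x∈ y∈ = [
        -- An output of `a` consumed in `post` becomes a term whose variables come from `s` or `v`.
        -- Nice modedness separates the former from the outputs of `post`, renaming apart the
        -- latter.
        (λ x∈t → inj₂ λ y∈post →
          [ (λ y∈s → inVars#post (y∈s , y∈post)) ,
            (λ y∈v → ¬common (inOuts y∈v) (inPost (outVars⊆queryVars post y∈post))) ]′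
            (∈-δ-out x∈t y∈)) ,
        (λ x∉t → [ (λ y∈s → inj₂ λ y∈post → inVars#post (y∈s , y∈post)) , inj₁ ]′
                   (∈-δ-∉ x∉t y∈)) ]′ (toSum (x ∈? vars* t))

    body#post : Disjoint (queryInVars (D ·ᵠ δ)) (queryOutVars (post ·ᵠ δ))
    body#post (y∈ , y∈′) =
      let x , x∈ , y∈x = ∈-queryInVars-· D y∈
          y∈post = subst (_ ∈_) (outs-fixed post inPost) y∈′
      in [ (λ y∈s → inVars#post (y∈s , y∈post)) ,
           (λ y≡x → ¬common (inBody (inVars⊆queryVars D x∈))
                      (inPost (outVars⊆queryVars post (subst (_∈ queryOutVars post) y≡x y∈post)))) ]′
           (∈-δ-∉ (bodyInVar x∈) y∈x)

    pre#rest : Disjoint (queryInVars (pre ·ᵠ δ)) (queryOutVars (D ·ᵠ δ ++ post ·ᵠ δ))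
    pre#rest {y} (y∈ , y∈′) with ∈-queryInVars-· pre y∈
    ... | x , x∈ , y∈x with subst (λ t → y ∈ vars t) (δ-pre x∈) y∈x
    ... | here refl with ∈-++⁻ (queryOutVars (D ·ᵠ δ))
                           (subst (y ∈_) (concatMap-++ outVars (D ·ᵠ δ) (post ·ᵠ δ)) y∈′)
    ... | inj₁ y∈D = ¬common
      (inBody (outVars⊆queryVars D (subst (y ∈_) (outs-fixed D inBody) y∈D)))
      (inPre (inVars⊆queryVars pre x∈))
    ... | inj₂ y∈post = proj₂ (proj₂ niceQ)
      (x∈ , ∈-++⁺ʳ (vars* t) (subst (y ∈_) (outs-fixed post inPost) y∈post))

    resolvent : Query
    resolvent = pre ++ D ++ post

    linear-resolvent : Unique (queryOutVars resolvent)
    linear-resolvent = subst Unique (sym (trans (concatMap-++ outVars pre (D ++ post))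
                                     (cong (queryOutVars pre ++_) (concatMap-++ outVars D post))))
      (Unique.++⁺ (proj₁ uniqueQ)
        (Unique.++⁺ (linear modedD) (proj₁ (proj₂ uniqueAP))
          (λ { (x∈D , x∈post) → ¬common (inBody (outVars⊆queryVars D x∈D))
                                        (inPost (outVars⊆queryVars post x∈post)) }))
        (λ { (x∈pre , x∈) → [
          (λ x∈D → ¬common (inBody (outVars⊆queryVars D x∈D))
                           (inPre (outVars⊆queryVars pre x∈pre))) ,
          (λ x∈post → proj₂ (proj₂ uniqueQ) (x∈pre , ∈-++⁺ʳ (vars* t) x∈post)) ]′
          (∈-++⁻ (queryOutVars D) x∈) }))

    varOuts-resolvent : All VariableOuts resolvent
    varOuts-resolvent = All.++⁺ (All.++⁻ˡ pre (varOuts modedQ))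
      (All.++⁺ (varOuts modedD) (All.tail (All.++⁻ʳ pre (varOuts modedQ))))

    moded-δ : Moded (resolvent ·ᵠ δ)
    moded-δ = moded
      (subst Unique (sym (outs-fixed resolvent outVar)) linear-resolvent)
      (subst Nice (sym (trans (map-++ (_·ᵃ δ) pre (D ++ post))
                              (cong (pre ·ᵠ δ ++_) (map-++ (_·ᵃ δ) D post))))
        (Nice-++⁺ (pre ·ᵠ δ) nice-pre (Nice-++⁺ (D ·ᵠ δ) nice-body nice-post body#post) pre#rest))
      (All.map⁺ (All.tabulate λ {b} b∈ k → subst IsVar
        (cong (λ ts → Vec.lookup ts k) (sym (·*-fixed (outs b)
          (λ x∈ → δ-outVar (outVar (∈-concatMap⁺ outVars (lose b∈ x∈)))))))
        (All.lookup varOuts-resolvent b∈ k)))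

    -- δ is a most general unifier, so any other one, θ, is δ followed by θ
    -- itself, which merely renames the variables introduced by δ.
    moded-resolvent : ∀ {θ} → MGU a h θ → Moded (resolvent ·ᵠ θ)
    moded-resolvent {θ} (unifies , general) = subst Moded
      (trans (·ᵠ-⊙ resolvent δ θ) (·ᵠ-cong resolvent absorbs))
      (Moded-rename {τ = τ} (resolvent ·ᵠ δ) undoes moded-δ)
      where
      τ = proj₁ (general δ δ-unifier)
      absorbs : ∀ x → δ x · θ ≡ θ x
      absorbs = δ-absorbs (proj₁ (atom-injective unifies)) (proj₂ (atom-injective unifies))
      -- Generality gives `δ x ≡ θ x · τ` and absorption `δ x · θ ≡ θ x`, so `θ` followed by `τ`
      -- fixes `δ x`, hence each variable in it.
      undoes : Undoes τ θ (queryVars (resolvent ·ᵠ δ))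
      undoes y∈ = let x , y∈x = ∈-queryVars-· resolvent y∈ in
        ·-injective (δ x) (trans (sym (·-⊙ (δ x) θ τ)) (trans (cong (_· τ) (absorbs x))
          (trans (sym (proj₂ (general δ δ-unifier) x)) (sym (·-var (δ x)))))) y∈x

  -- Types are passed along the order: `pre` types the inputs of `a`, and so of `h`; these type the
  -- body, whose outputs type those of `h`, and so of `a`, on which `post` relies. The transfers
  -- between `a` and `h` rest on their common instance.
  typed-resolvent : ∀ {a h θ pre post D} → Unifier a h θ →
    Typed (const ⊤) (pre ++ a ∷ post) → Typed (InsTyped h) D →
    (∀ σ → InsTyped h σ → AllOutsTyped D σ → OutsTyped h σ) →
    Typed (const ⊤) ((pre ++ D ++ post) ·ᵠ θ)
  typed-resolvent {a} {h} {θ} {pre} {post} {D} unifies typedQ typedD typedHead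
    with Typed-++⁻ pre typedQ
  ... | typedPre , typedA , typedPost =
    subst (Typed _) (sym (trans (map-++ (_·ᵃ θ) pre (D ++ post))
                                (cong (pre ·ᵠ θ ++_) (map-++ (_·ᵃ θ) D post))))
      (Typed-++⁺ (pre ·ᵠ θ) (Typed-· pre θ _ typedPre)
        (Typed-++⁺ (D ·ᵠ θ)
          (Typed-· D θ (λ { τ (_ , os) → insTyped τ os }) typedD)
          (Typed-· post θ (λ { τ ((_ , os) , os′) → (tt , AllOutsTyped-·⁻ pre θ τ os) ,
            OutsTyped-·⁻ a θ τ (subst (λ b → OutsTyped b τ) (sym unifies)
              (OutsTyped-·⁺ h θ τ (typedHead (θ ⊙ τ) (insTyped τ os)
                (AllOutsTyped-·⁻ D θ τ os′)))) }) typedPost)))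
    where
    insTyped : ∀ τ → AllOutsTyped (pre ·ᵠ θ) τ → InsTyped h (θ ⊙ τ)
    insTyped τ os = InsTyped-·⁻ h θ τ (subst (λ b → InsTyped b τ) unifies
      (InsTyped-·⁺ a θ τ (typedA (θ ⊙ τ) (tt , AllOutsTyped-·⁻ pre θ τ os))))

  -- Ground inputs

  -- The outputs are distinct variables, so each can be sent independently to a chosen member of its
  -- type.
  typing : NonEmptyTypes → ∀ O → Unique (queryOutVars O) → All VariableOuts O →
           ∃[ σ ] AllOutsTyped O σ
  typing nonEmpty []      _      _       = var , []
  typing nonEmpty (a ∷ O) unique (v ∷ vs) with Unique-++⁻ (outVars a) unique
  ... | uniqueA , uniqueO , disjoint
    with matches* (outs a) (Vec.tabulate witness) uniqueA (λ k → var-matches (v k) _)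
       | typing nonEmpty O uniqueO vs
    where
    witness : Fin (#out (pred a)) → Term
    witness k = proj₁ (nonEmpty (pred a) (inj₂ k))
  ... | μ , eq | σ , os = glue (outVars a) μ σ ,
    (λ k → subst (_∶ outType (pred a) k)
      (sym (trans (·-cong (Vec.lookup (outs a) k)
                    (λ x∈ → glue-∈ (outVars a) μ σ (∈-vars*⁺ (outs a) k x∈)))
             (trans (sym (lookup-·* (outs a) k μ))
               (trans (cong (λ ts → Vec.lookup ts k) eq) (Vec.lookup∘tabulate _ k)))))
      (proj₂ (nonEmpty (pred a) (inj₂ k)))) ∷
    All.tabulate (λ {b} b∈ k → subst (_∶ outType (pred b) k)
      (·-cong (Vec.lookup (outs b) k) (λ x∈ → sym (glue-∉ (outVars a) μ σ λ x∈a →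
        disjoint (x∈a , ∈-concatMap⁺ outVars (lose b∈ (∈-vars*⁺ (outs b) k x∈))))))
      (All.lookup os b∈ k))

  -- A substitution that types every output turns this input into a constant, and instantiation
  -- cannot change a root symbol.
  constantInput : NonEmptyTypes → ∀ {O a} → Moded O → Typed (const ⊤) O → a ∈ O →
    ∀ k → ConstantType (inType (pred a) k) → IsVar (arg a (inj₁ k)) ⊎ Ground (arg a (inj₁ k))
  constantInput nonEmpty {O} {a} m typed a∈ k const-k
    with typing nonEmpty O (Moded.linear m) (Moded.varOuts m) | ∈-∃++ a∈
  ... | σ , os | pre , post , refl
    with constant-·⁻ (arg a (inj₁ k)) σ
           (const-k _ (proj₁ (proj₂ (Typed-++⁻ pre typed)) σ (tt , All.++⁻ˡ pre os) k))
  ... | inj₁ v = inj₁ v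
  ... | inj₂ c = inj₂ (constant⇒ground _ c)

  -- Derivation steps

  -- Going to a variant and back fixes the clause, hence each of its variables.
  ·ᶜ-undoes : ∀ {C σ τ} → C ·ᶜ σ ·ᶜ τ ≡ C → Undoes τ σ (clauseVars C)
  ·ᶜ-undoes {h ⟵ B} {σ} {τ} eq x∈ =
    [ atom-undoes h (cong head eq) , query-undoes ]′ (∈-++⁻ (atomVars h) x∈)
    where
    vec-undoes : ∀ {n} (ts : Vec Term n) → ts ·* σ ·* τ ≡ ts → Undoes τ σ (vars* ts)
    vec-undoes ts eq = ·*-injective ts (trans (sym (·*-⊙ ts σ τ)) (trans eq (sym (·*-var ts))))
    atom-undoes : ∀ a → a ·ᵃ σ ·ᵃ τ ≡ a → Undoes τ σ (atomVars a)
    atom-undoes (atom p s t) eq x∈ with atom-injective eq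
    ... | eqᵢ , eqₒ = [ vec-undoes s eqᵢ , vec-undoes t eqₒ ]′ (∈-++⁻ (vars* s) x∈)
    query-undoes : Undoes τ σ (queryVars B)
    query-undoes x∈ =
      let b , b∈ , x∈b = find (∈-concatMap⁻ atomVars {B} x∈)
          fixed = map-fixed⁻ (λ a → a ·ᵃ σ ·ᵃ τ) B (trans (map-∘ B) (cong body eq))
      in atom-undoes b (All.lookup fixed b∈) x∈b

  module _ (nonEmpty : NonEmptyTypes) {𝓑 : Pred → Set} {P : Program}
    (simply : PermutationSimplyTyped P) (ground : BGroundProgram 𝓑 P)
    (determined : HeadDetermined 𝓑 P) (inputLinear : InputLinear P)
    (selectability : InputSelectability P)
    where

    -- The variant is written as `C ·ᶜ σ` because flatness, typing and 𝓑-positions concern the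
    -- program clause, whereas renaming apart and unification concern the variant.
    resolve : ∀ {left right p s t u v B σ σ′ θ} →
      let a = atom p s t
          C = atom p u v ⟵ B
      in
      IsClause P C → C ·ᶜ σ ·ᶜ σ′ ≡ C →
      Disjoint (clauseVars (C ·ᶜ σ)) (queryVars (left ++ a ∷ right)) →
      MGU a (head C ·ᵃ σ) θ → Selectable P a →
      BGroundQuery 𝓑 (left ++ a ∷ right) →
      BGroundQuery 𝓑 ((left ++ B ·ᵠ σ ++ right) ·ᵠ θ)
    resolve {left} {right} {p} {s} {t} {u} {v} {B} {σ} {σ′} {θ}
      clause renaming′ apart mgu selectable ((π , niceQ , typedQ , varOutsQ) , groundQ)
      with arrange (left ++ atom p s t ∷ right) π {const ⊤} niceQ (λ i σ _ → typedQ i σ) varOutsQ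
         | simply _ clause
    ... | O , Q↭O , modedO , typedO
        | π′ , (niceB , headNice) , (typedB , typedHead) , varOutsB , headInputs
      with arrange B π′ niceB typedB varOutsB | ∈-∃++ (∈-resp-↭ Q↭O (∈-insert left))
    ... | D , B↭D , modedD , typedD | pre , post , refl =
      unarrange (↭.map⁺ (_·ᵃ θ) resolvent↭)
        (Resolvent.moded-resolvent {pre = pre} {post} {D ·ᵠ σ} modedO
          (Moded-rename D undoesD modedD)
          (Disjoint-rename u D undoesIns undoesD
            (λ { (x∈u , x∈D) → headNice (x∈u , ∈-resp-↭ (concatMap-↭ outVars (↭-sym B↭D)) x∈D) }))
          (λ { (x∈C , x∈O) → apart (
            ∈-resp-↭ (↭.++⁺ˡ (atomVars (atom p (u ·* σ) (v ·* σ)))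
              (concatMap-↭ atomVars (↭.map⁺ (_·ᵃ σ) (↭-sym B↭D)))) x∈C ,
            ∈-resp-↭ (concatMap-↭ atomVars (↭-sym Q↭O)) x∈O) })
          match mgu)
        (typed-resolvent {pre = pre} (proj₁ mgu) typedO
          (Typed-· D σ (λ τ → InsTyped-·⁻ h σ τ) typedD)
          (λ τ ins outs → OutsTyped-·⁺ h σ τ (typedHead (σ ⊙ τ) (InsTyped-·⁻ h σ τ ins)
            (λ j → All.lookup (All-resp-↭ (↭-sym B↭D) (AllOutsTyped-·⁻ D σ τ outs)) (∈-lookup j))))) ,
      groundResolvent
      where
      h = atom p u v
      a = atom p s t

      undoes = ·ᶜ-undoes {h ⟵ B} renaming′

      undoesD : Undoes σ′ σ (queryVars D)
      undoesD x∈ = undoes (∈-++⁺ʳ (atomVars h) (∈-resp-↭ (concatMap-↭ atomVars (↭-sym B↭D)) x∈))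

      undoesIns : Undoes σ′ σ (vars* u)
      undoesIns x∈ = undoes (∈-++⁺ˡ (∈-++⁺ˡ x∈))

      -- The selected atom is cancelled from both sides of `Q↭O`, and the two forms of the body are
      -- put in its place.
      resolvent↭ : left ++ B ·ᵠ σ ++ right ↭ pre ++ D ·ᵠ σ ++ post
      resolvent↭ = ↭-trans (↭.shifts left (B ·ᵠ σ))
        (↭-trans (↭.++⁺ (↭.map⁺ (_·ᵃ σ) B↭D) (drop-mid left pre Q↭O)) (↭.shifts (D ·ᵠ σ) pre))

      unifiesIns : ∀ k → Vec.lookup u k · (σ ⊙ θ) ≡ Vec.lookup s k · θ
      unifiesIns k = trans (sym (lookup-·*-⊙ u k σ θ)) (trans (sym (lookup-·* (u ·* σ) k θ))
        (trans (cong (λ ts → Vec.lookup ts k) (sym (proj₁ (atom-injective (proj₁ mgu)))))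
          (lookup-·* s k θ)))

      varOutsA : VariableOuts a
      varOutsA = All.lookup (Moded.varOuts modedO) (∈-insert pre)

      -- A non-variable head input marks a bound position, where input selectability makes the
      -- selected atom non-variable, as `flat-matches` demands. Input linearity combines the
      -- positions.
      headMatch : ∃[ μ ] u ·* μ ≡ s
      headMatch = matches* u s (proj₁ inputLinear _ clause) λ k →
        flat-matches (Vec.lookup s k) (proj₁ (headInputs k))
          (λ nonVar → proj₁ (selectability a (inHead clause) (λ k _ → varOutsA k))
                        selectable k (input clause k nonVar))
          (unifiesIns k)

      match : u ·* σ ·* (σ′ ⊙ proj₁ headMatch) ≡ s
      match = trans (sym (·*-⊙ (u ·* σ) σ′ (proj₁ headMatch)))
        (trans (cong (_·* proj₁ headMatch) (proj₁ (atom-injective (cong head renaming′))))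
          (proj₂ headMatch))

      BPosition⇒ground : ∀ k → BPosition 𝓑 P p (inj₁ k) → ConstantType (inType p k) →
                         Ground (Vec.lookup s k)
      BPosition⇒ground k bpos const-k
        with constantInput nonEmpty modedO typedO (∈-insert pre) k const-k
      ... | inj₂ g       = g
      -- Membership in `𝓑` may be undecidable, but to refute a variable it can be assumed under
      -- double negation: outside `𝓑` a selectable atom is non-variable here, and inside `𝓑` its
      -- inputs are ground.
      ... | inj₁ isVar-k = ⊥-elim (¬¬𝓑 λ 𝓑p → nonGround isVar-k (groundQ a (∈-insert left) 𝓑p k))
        where
        nonGround : ∀ {t} → IsVar t → ¬ Ground t
        nonGround (var x) g = g x (here refl)
        ¬¬𝓑 : ¬ ¬ 𝓑 p
        ¬¬𝓑 ¬𝓑p = proj₂ ground a ¬𝓑p selectable (inj₁ k) bpos isVar-k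

      headPosition : ∀ {x} → x ∈ atomVars h → ∃[ k ] x ∈ vars (arg h k)
      headPosition x∈ with ∈-++⁻ (vars* u) x∈
      ... | inj₁ x∈u = let k , x∈k = ∈-vars*⁻ u x∈u in inj₁ k , x∈k
      ... | inj₂ x∈v = let k , x∈k = ∈-vars*⁻ v x∈v in inj₂ k , x∈k

      -- Type consistency provides an instance that is a constant; a term containing a variable has
      -- such an instance only if it is that variable.
      headInput : ∀ k → ConstantType (inType p k) → ∀ {x} → x ∈ vars (Vec.lookup u k) →
                  Vec.lookup u k ≡ var x
      headInput k const-k x∈ with Vec.lookup u k | proj₁ (proj₂ (headInputs k)) | x∈
      ... | var _    | _          | here refl = refl
      ... | fun f ts | ρ , typed  | x∈ts with constant-·⁻ (fun f ts) ρ (const-k _ typed)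
      ...   | inj₂ c = ⊥-elim (constant⇒ground _ c _ x∈ts)

      -- `x` is the whole head input at some 𝓑-position `i`, so unification identifies `σ x · θ`
      -- with an instance of the `i`-th input of `a`, which is ground.
      groundBody : ∀ {b x} → b ∈ B → 𝓑 (pred b) → x ∈ inVars b → Ground (σ x · θ)
      groundBody {b} {x} b∈ 𝓑b x∈
        with headPosition (determined _ b x clause b∈ 𝓑b x∈)
      ... | k , x∈k with position clause b∈ 𝓑b x∈ k x∈k
      ... | bpos with proj₁ ground p k bpos
      ... | i , refl , const-i = λ y y∈ →
        let z , z∈ , _ = ∈-vars-·⁻ (Vec.lookup s i)
              (subst (λ t → y ∈ vars t)
                (trans (cong (_· (σ ⊙ θ)) (sym (headInput i const-i x∈k))) (unifiesIns i)) y∈)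
        in BPosition⇒ground i bpos const-i z z∈

      ground-· : ∀ {n} (ts : Vec Term n) τ → (∀ {x} → x ∈ vars* ts → Ground (τ x)) →
                 ∀ k → Ground (Vec.lookup (ts ·* τ) k)
      ground-· ts τ g k y y∈ = let x , x∈ , y∈x = ∈-vars*-·⁻ ts (∈-vars*⁺ (ts ·* τ) k y∈)
                               in g x∈ y y∈x

      groundOld : ∀ {b} → b ∈ left ++ a ∷ right → 𝓑 (pred b) →
                  ∀ k → Ground (Vec.lookup (ins (b ·ᵃ θ)) k)
      -- A ground input has no variable for `θ` to act on, so the assumption of `ground-·` holds
      -- vacuously.
      groundOld {b} b∈ 𝓑b = ground-· (ins b) θ λ x∈ →
        let k , x∈k = ∈-vars*⁻ (ins b) x∈ in ⊥-elim (groundQ b b∈ 𝓑b k _ x∈k)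

      groundResolvent : ∀ c → c ∈ (left ++ B ·ᵠ σ ++ right) ·ᵠ θ → 𝓑 (pred c) →
                        ∀ k → Ground (Vec.lookup (ins c) k)
      groundResolvent c c∈ 𝓑c with ∈-map⁻ (_·ᵃ θ) c∈
      ... | b , b∈ , refl with ∈-++⁻ left b∈
      ...   | inj₁ b∈left = groundOld (∈-++⁺ˡ b∈left) 𝓑c
      ...   | inj₂ b∈′ with ∈-++⁻ (B ·ᵠ σ) b∈′
      ...     | inj₂ b∈right = groundOld (∈-++⁺ʳ left (there b∈right)) 𝓑c
      ...     | inj₁ b∈B with ∈-map⁻ (_·ᵃ σ) b∈B
      ...       | d , d∈ , refl = subst (λ ts → ∀ k → Ground (Vec.lookup ts k))
        (sym (·*-⊙ (ins d) σ θ)) (ground-· (ins d) (σ ⊙ θ) (groundBody d∈ 𝓑c))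

    step-BGround : ∀ {Q Q′} (st : Step P Q Q′) → Selectable P (Step.selected st) →
                   BGroundQuery 𝓑 Q → BGroundQuery 𝓑 Q′
    -- Argument vectors are indexed by their predicate, so the unifier is first used to identify `q`
    -- with `p`.
    step-BGround record
      { selected = atom p s t ; clause = atom q u v ⟵ B ; source = refl ; target = refl
      ; isVariant = (σ , refl) , σ′ , eq ; inProgram = c ; apart = d ; isMGU = mgu }
      selectable bg with cong pred (proj₁ mgu)
    ... | refl = resolve c eq d mgu selectable bg

    derivation-BGround : ∀ {Q} (ξ : Derivation P Q) → DelayRespecting ξ → BGroundQuery 𝓑 Q →
                         ∀ i → i ≤∞ #steps ξ → BGroundQuery 𝓑 (query ξ i)
    derivation-BGround ξ delay bg zero    _  = subst (BGroundQuery 𝓑) (sym (start ξ)) bg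
    derivation-BGround ξ delay bg (suc i) i< = step-BGround (step ξ i i<) (delay i i<)
      (derivation-BGround ξ delay bg i (≤∞-pred (#steps ξ) i<))
      where
      ≤∞-pred : ∀ n → suc i ≤∞ n → i ≤∞ n
      ≤∞-pred (just n) = ℕ.<⇒≤
      ≤∞-pred nothing  = const tt

theorem7p3 : (L : Language) → let open Programs L in
    NonEmptyTypes →
    (𝓑 : Pred → Set) → ConstantInputs 𝓑 →
    (P : Program) → PermutationSimplyTyped P →
    BGroundProgram 𝓑 P → HeadDetermined 𝓑 P →
    InputLinear P → InputSelectability P →
    (Q : Query) → BGroundQuery 𝓑 Q →
    (ξ : Derivation P Q) → DelayRespecting ξ →
    ∀ R → R QueryOf ξ → BGroundQuery 𝓑 R
theorem7p3 L nonEmpty 𝓑 _ P simply ground determined linear selectability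
  Q bg ξ delay R (i , i≤ , refl) =
  Resolution.derivation-BGround L nonEmpty simply ground determined linear selectability
    ξ delay bg i i≤
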